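{- Let $(\nu_1,S_1)$ and $(\nu_2,S_2)$ be well-formed configurations and $(\nu_1,S_1,M_1)\bowtie(\nu_2,S_2,M_2)$. If $(\nu_1,S_1,M_1)\mid(\nu_2,S_2,M_2)\xrightarrow{\ell}(\nu_1',S_1',M_1')\mid(\nu_2',S_2',M_2')$ is a system transition (for some label $\ell$), then $(\nu_1',S_1')$ and $(\nu_2',S_2')$ are well-formed.
   Context: Clocks, valuations $\nu:\mathcal X\to\mathbb{R}_{\ge0}$, $\nu+t$, resets $\nu[\lambda\mapsto0]$; clock constraints $\delta ::= \mathrm{true} \mid x>n \mid x=n \mid x-y>n \mid x-y=n \mid \neg\delta \mid \delta_1\wedge\delta_2$; $\nu\models\downarrow\delta$ iff $\exists t\ge0.\ \nu+t\models\delta$; $\delta[\lambda\mapsto 0]\models\gamma$ means $\nu[\lambda\mapsto0]\models\gamma$ whenever $\nu\models\delta$. Types: $S ::= \{c_i\, l_i\langle T_i\rangle(\delta_i,\lambda_i).S_i\}_{i\in I} \mid \mu\alpha.S \mid \alpha \mid \mathrm{end}$ ($I\ne\emptyset$, $c_i\in\{!,?\}$, distinct labels, $T_i$ a base sort or delegation $(\delta',S')$, contractive recursion). Dual $\overline S$: swap every $!$ with $?$, keeping everything else. Well-formedness rules for $A;\delta\vdash S$: (end) $A;\mathrm{true}\vdash\mathrm{end}$; (rec) $A;\delta\vdash\mu\alpha.S$ if $A,\alpha:\delta;\delta\vdash S$; (var) $A,\alpha:\delta;\delta\vdash\alpha$; (choice) $A;\downarrow(\bigvee_i\delta_i)\vdash\{c_i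 l_i\langle T_i\rangle(\delta_i,\lambda_i).S_i\}_{i\in I}$ if for each $i$ some $\gamma_i$ satisfies $A;\gamma_i\vdash S_i$ and $\delta_i[\lambda_i\mapsto0]\models\gamma_i$, for all $i\ne j$ either $\delta_i\wedge\delta_j\models\mathrm{false}$ or $c_i=c_j$, and each delegated $T_i=(\delta',S')$ has some $\gamma'$ with $\emptyset;\gamma'\vdash S'$, $\delta'\models\gamma'$. $(\nu,S)$ is well-formed if $\emptyset;\delta\vdash S$ and $\nu\models\delta$ for some $\delta$. Semantics with messages $m=l\langle T\rangle$: (act) $(\nu,\{c_i l_i\langle T_i\rangle(\delta_i,\lambda_i).S_i\}_{i})\xrightarrow{c_j l_j\langle T_j\rangle}(\nu[\lambda_j\mapsto0],S_j)$ if $\nu\models\delta_j$; (unfold) $(\nu,\mu\alpha.S)\xrightarrow{\ell}C'$ if $(\nu,S[\mu\alpha.S/\alpha])\xrightarrow{\ell}C'$; (tick) $(\nu,S)\xrightarrow{t}(\nu+t,S)$; future-enabled means $(\nu,S)\xrightarrow{t}\xrightarrow{c\,m}$ for some $t,c,m$. Queued configurations $(\nu,S,M)$, FIFO $M::=\emptyset\mid m;M$: (send) $(\nu,S,M)\xrightarrow{!m}(\nu',S',M)$ if $(\nu,S)\xrightarrow{!m}(\nu',S')$; (recv) $(\nu,S,m;M)\xrightarrow{\tau}(\nu',S',M)$ if $(\nu,S)\xrightarrow{?m}(\nu',S')$; (que) $(\nu,S,M)\xrightarrow{?m}(\nu,S,M;m)$; (time) $(\nu,S,M)\xrightarrow{t}(\nu',S',M)$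 if $(\nu,S)\xrightarrow{t}(\nu',S')$, future-enabledness is preserved, and $(\nu+t',S,M)$ has no $\tau$-transition for any $t'<t$. System transitions on $C_1\mid C_2$: (com) $\xrightarrow{\tau}C_1'\mid C_2'$ if $C_1\xrightarrow{!m}C_1'$, $C_2\xrightarrow{?m}C_2'$ (and symmetrically); (par) $\xrightarrow{\tau}C_1'\mid C_2$ if $C_1\xrightarrow{\tau}C_1'$ (and symmetrically); (wait) $\xrightarrow{t}C_1'\mid C_2'$ if both $C_k\xrightarrow{t}C_k'$. Compatibility $\bowtie$ is the largest relation such that $(\nu_1,S_1,M_1)\bowtie(\nu_2,S_2,M_2)$ implies: (1) $M_1=\emptyset$ or $M_2=\emptyset$; (2) if $M_1=m;M_1'$ then $(\nu_1,S_1)\xrightarrow{?m}(\nu_1',S_1')$ and $(\nu_1',S_1',M_1')\bowtie(\nu_2,S_2,M_2)$; (3) symmetrically for $M_2=m;M_2'$; (4) if $M_1=\emptyset=M_2$ then $S_1=\overline{S_2}$ and $\nu_1=\nu_2$. -}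

module Defs where

open import Level using (Level) renaming (suc to lsuc; zero to lzero)
open import Data.Nat using (ℕ; zero; suc) renaming (_≟_ to _≟ℕ_)
open import Data.Fin using (Fin)
open import Data.Bool using (Bool; true; false; if_then_else_)
open import Data.Vec using (Vec; lookup)
open import Data.List using (List; []; _∷_; _++_; [_])
open import Data.List.Membership.Propositional using (_∈_)
open import Data.List.Relation.Unary.All using (All)
open import Data.List.Relation.Unary.Any using (Any)
open import Data.List.Relation.Unary.AllPairs using (AllPairs)
open import Data.Product using (Σ; ∃; ∃-syntax; _×_; _,_; proj₁; proj₂)
open import Data.Sum using (_⊎_; inj₁; inj₂)
open import Data.Empty using (⊥)
open import Data.Unit using (⊤)
open import Relation.Nullary using (¬_; yes; no)
open import Relation.Binary.PropositionalEquality using (_≡_; refl; sym; trans; cong; subst)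
open import Algebra.Structures using (IsCommutativeRing)

-- The real numbers, given axiomatically as a (Dedekind-)complete
-- ordered field.  Any two such structures are isomorphic, so quantifying
-- over all `Reals` is the same as speaking about ℝ.

record Reals : Set₁ where
  infixl 6 _+_
  infixl 7 _*_
  infix 4 _<_
  field
    ℝ : Set
    0ℝ 1ℝ : ℝ
    _+_ _*_ : ℝ → ℝ → ℝ
    -_ : ℝ → ℝ
    _<_ : ℝ → ℝ → Set
    isCommutativeRing : IsCommutativeRing _≡_ _+_ _*_ -_ 0ℝ 1ℝ
    0≢1 : ¬ (0ℝ ≡ 1ℝ)
    *-inverse : ∀ x → ¬ (x ≡ 0ℝ) → ∃[ y ] (x * y ≡ 1ℝ)
    <-irrefl : ∀ x → ¬ (x < x)
    <-trans : ∀ {x y z} → x < y → y < z → x < z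
    <-trichotomy : ∀ x y → x < y ⊎ x ≡ y ⊎ y < x
    +-monoˡ-< : ∀ {x y} z → x < y → x + z < y + z
    *-pos : ∀ {x y} → 0ℝ < x → 0ℝ < y → 0ℝ < x * y
    -- least upper bound property (x ≤ y written out as x < y ⊎ x ≡ y)
    sup : (P : ℝ → Set) → ∃ P → (∃[ b ] (∀ x → P x → x < b ⊎ x ≡ b)) →
          ∃[ s ] ((∀ x → P x → x < s ⊎ x ≡ s) ×
                  (∀ b → (∀ x → P x → x < b ⊎ x ≡ b) → s < b ⊎ s ≡ b))

  infix 4 _≤_
  _≤_ : ℝ → ℝ → Set
  x ≤ y = x < y ⊎ x ≡ y

  _-_ : ℝ → ℝ → ℝ
  x - y = x + (- y)

  fromℕ : ℕ → ℝ
  fromℕ zero = 0ℝ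
  fromℕ (suc n) = 1ℝ + fromℕ n

  open IsCommutativeRing isCommutativeRing using (+-identityʳ; +-comm)

  private
    ≤-<-trans : ∀ {x y z} → x ≤ y → y < z → x < z
    ≤-<-trans (inj₁ p) q = <-trans p q
    ≤-<-trans (inj₂ refl) q = q

  +-nonneg : ∀ {a b} → 0ℝ ≤ a → 0ℝ ≤ b → 0ℝ ≤ a + b
  +-nonneg {a} {b} p (inj₂ refl) = subst (0ℝ ≤_) (sym (+-identityʳ a)) p
  +-nonneg {a} {b} p (inj₁ q) =
    inj₁ (≤-<-trans (subst (0ℝ ≤_) (sym (+-identityʳ a)) p)
           (subst₂' (+-comm 0ℝ a) (+-comm b a) (+-monoˡ-< a q)))
    where
    subst₂' : ∀ {u v u' v'} → u ≡ u' → v ≡ v' → u < v → u' < v'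
    subst₂' refl refl r = r

  record ℝ≥0 : Set where
    constructor _,≥0_
    field
      val    : ℝ
      nonneg : 0ℝ ≤ val
  open ℝ≥0 public

  0≥0 : ℝ≥0
  0≥0 = 0ℝ ,≥0 inj₂ refl

  _+≥0_ : ℝ≥0 → ℝ≥0 → ℝ≥0
  a +≥0 b = (val a + val b) ,≥0 +-nonneg (nonneg a) (nonneg b)

module Timed (R : Reals) (k : ℕ) where
  open Reals R public

  Clock : Set
  Clock = Fin k

  Val : Set
  Val = Clock → ℝ≥0

  _⊕_ : Val → ℝ≥0 → Val
  (ν ⊕ t) x = ν x +≥0 t

  -- sets of clocks to reset, as characteristic vectors
  Resets : Set
  Resets = Vec Bool k

  reset : Val → Resets → Val
  reset ν λs x = if lookup λs x then 0≥0 else ν x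

  data Guard : Set where
    tt   : Guard
    gt   : Clock → ℕ → Guard
    eq   : Clock → ℕ → Guard
    dgt  : Clock → Clock → ℕ → Guard
    deq  : Clock → Clock → ℕ → Guard
    not  : Guard → Guard
    and  : Guard → Guard → Guard

  Pred : Set₁
  Pred = Val → Set

  ⟦_⟧ : Guard → Pred
  ⟦ tt ⟧ ν = ⊤
  ⟦ gt x n ⟧ ν = fromℕ n < val (ν x)
  ⟦ eq x n ⟧ ν = val (ν x) ≡ fromℕ n
  ⟦ dgt x y n ⟧ ν = fromℕ n < val (ν x) - val (ν y)
  ⟦ deq x y n ⟧ ν = val (ν x) - val (ν y) ≡ fromℕ n
  ⟦ not g ⟧ ν = ¬ ⟦ g ⟧ ν
  ⟦ and g h ⟧ ν = ⟦ g ⟧ ν × ⟦ h ⟧ ν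

  ↓_ : Pred → Pred
  (↓ δ) ν = ∃[ t ] δ (ν ⊕ t)

  _≐_ : Pred → Pred → Set
  δ ≐ γ = ∀ ν → (δ ν → γ ν) × (γ ν → δ ν)

  data Pol : Set where
    out inp : Pol

  Label : Set
  Label = ℕ

  TyVar : Set
  TyVar = ℕ

  mutual
    data Payload : Set where
      base  : ℕ → Payload
      deleg : Guard → Ty → Payload

    data Branch : Set where
      br : Pol → Label → Payload → Guard → Resets → Ty → Branch

    data Ty : Set where
      choice : List Branch → Ty
      μ      : TyVar → Ty → Ty
      var    : TyVar → Ty
      end    : Ty

  pol : Branch → Pol
  pol (br c _ _ _ _ _) = c
  label : Branch → Label
  label (br _ l _ _ _ _) = l
  payload : Branch → Payload
  payload (br _ _ p _ _ _) = p
  guard : Branch → Guard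
  guard (br _ _ _ g _ _) = g
  resets : Branch → Resets
  resets (br _ _ _ _ r _) = r
  cont : Branch → Ty
  cont (br _ _ _ _ _ S) = S

  flip : Pol → Pol
  flip out = inp
  flip inp = out

  mutual
    dual : Ty → Ty
    dual (choice bs) = choice (dualBs bs)
    dual (μ α S) = μ α (dual S)
    dual (var α) = var α
    dual end = end

    dualBs : List Branch → List Branch
    dualBs [] = []
    dualBs (br c l p g r S ∷ bs) = br (flip c) l p g r (dual S) ∷ dualBs bs

  -- substitution S[T/α] (only used with closed T, so no capture)
  mutual
    _[_/_] : Ty → Ty → TyVar → Ty
    choice bs [ T / α ] = choice (substBs bs T α)
    μ β S [ T / α ] with α ≟ℕ β
    ... | yes _ = μ β S
    ... | no  _ = μ β (S [ T / α ])
    var β [ T / α ] with α ≟ℕ β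
    ... | yes _ = T
    ... | no  _ = var β
    end [ T / α ] = end

    substBs : List Branch → Ty → TyVar → List Branch
    substBs [] T α = []
    substBs (br c l p g r S ∷ bs) T α = br c l p g r (S [ T / α ]) ∷ substBs bs T α

  -- syntactic side conditions of the grammar: nonempty choices,
  -- distinct labels, contractive recursion (also inside delegations)
  IsVarBody : Ty → Set
  IsVarBody (var _) = ⊤
  IsVarBody (μ _ S) = IsVarBody S
  IsVarBody _ = ⊥

  mutual
    data GoodTy : Ty → Set where
      choice : ∀ {b bs} → GoodBs (b ∷ bs) →
               AllPairs (λ b₁ b₂ → ¬ (label b₁ ≡ label b₂)) (b ∷ bs) →
               GoodTy (choice (b ∷ bs))
      μ      : ∀ {α S} → ¬ IsVarBody S → GoodTy S → GoodTy (μ α S)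
      var    : ∀ {α} → GoodTy (var α)
      end    : GoodTy end

    data GoodBs : List Branch → Set where
      []  : GoodBs []
      _∷_ : ∀ {c l p g r S bs} → GoodPayload p → GoodTy S → GoodBs bs →
            GoodBs (br c l p g r S ∷ bs)

    data GoodPayload : Payload → Set where
      base  : ∀ {n} → GoodPayload (base n)
      deleg : ∀ {g S} → GoodTy S → GoodPayload (deleg g S)

  Ctx : Set₁
  Ctx = List (TyVar × Pred)

  data _∋_∶_ : Ctx → TyVar → Pred → Set₁ where
    here  : ∀ {A α δ} → ((α , δ) ∷ A) ∋ α ∶ δ
    there : ∀ {A α β δ γ} → ¬ (α ≡ β) → A ∋ α ∶ δ → ((β , γ) ∷ A) ∋ α ∶ δ

  mutual
    data _⨾_⊢_ : Ctx → Pred → Ty → Set₁ where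
      ⊢end    : ∀ {A δ} → δ ≐ (λ _ → ⊤) → A ⨾ δ ⊢ end
      ⊢rec    : ∀ {A δ α S} → ((α , δ) ∷ A) ⨾ δ ⊢ S → A ⨾ δ ⊢ μ α S
      ⊢var    : ∀ {A δ δ' α} → A ∋ α ∶ δ' → δ ≐ δ' → A ⨾ δ ⊢ var α
      ⊢choice : ∀ {A δ bs} →
                δ ≐ (↓ (λ ν → Any (λ b → ⟦ guard b ⟧ ν) bs)) →
                All (BranchOK A) bs →
                AllPairs (λ b₁ b₂ → (∀ ν → ¬ (⟦ guard b₁ ⟧ ν × ⟦ guard b₂ ⟧ ν))
                                    ⊎ pol b₁ ≡ pol b₂) bs →
                A ⨾ δ ⊢ choice bs

    data BranchOK (A : Ctx) : Branch → Set₁ where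
      ok : ∀ {c l p g r S} (γ : Pred) → A ⨾ γ ⊢ S →
           (∀ ν → ⟦ g ⟧ ν → γ (reset ν r)) → PayloadOK p →
           BranchOK A (br c l p g r S)

    data PayloadOK : Payload → Set₁ where
      base  : ∀ {n} → PayloadOK (base n)
      deleg : ∀ {g S} (γ : Pred) → [] ⨾ γ ⊢ S → (∀ ν → ⟦ g ⟧ ν → γ ν) →
              PayloadOK (deleg g S)

  WellFormed : Val → Ty → Set₁
  WellFormed ν S = Σ Pred λ δ → ([] ⨾ δ ⊢ S) × δ ν

  data Msg : Set where
    msg : Label → Payload → Msg

  data Act : Val → Ty → Pol → Msg → Val → Ty → Set where
    act    : ∀ {ν bs b} → b ∈ bs → ⟦ guard b ⟧ ν →
             Act ν (choice bs) (pol b) (msg (label b) (payload b))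
                 (reset ν (resets b)) (cont b)
    unfold : ∀ {ν α S c m ν' S'} → Act ν (S [ μ α S / α ]) c m ν' S' →
             Act ν (μ α S) c m ν' S'

  -- (tick) is (ν, S) --t--> (ν ⊕ t, S);  future-enabled:
  FutureEnabled : Val → Ty → Set
  FutureEnabled ν S = ∃[ t ] ∃[ c ] ∃[ m ] ∃[ ν' ] ∃[ S' ] Act (ν ⊕ t) S c m ν' S'

  Queue : Set
  Queue = List Msg

  GoodMsg : Msg → Set
  GoodMsg (msg _ p) = GoodPayload p

  QConf : Set
  QConf = Val × Ty × Queue

  data QLabel : Set where
    act   : Pol → Msg → QLabel
    τ     : QLabel
    delay : ℝ≥0 → QLabel

  data QTau : QConf → QConf → Set where
    recv : ∀ {ν S m M ν' S'} → Act ν S inp m ν' S' → QTau (ν , S , m ∷ M) (ν' , S' , M)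

  data QStep : QConf → QLabel → QConf → Set where
    send : ∀ {ν S M m ν' S'} → Act ν S out m ν' S' → QStep (ν , S , M) (act out m) (ν' , S' , M)
    recv : ∀ {C C'} → QTau C C' → QStep C τ C'
    que  : ∀ {ν S M m} → QStep (ν , S , M) (act inp m) (ν , S , M ++ [ m ])
    time : ∀ {ν S M t} →
           (FutureEnabled ν S → FutureEnabled (ν ⊕ t) S) →
           (∀ t' → val t' < val t → ∀ C' → ¬ QTau (ν ⊕ t' , S , M) C') →
           QStep (ν , S , M) (delay t) (ν ⊕ t , S , M)

  data SLabel : Set where
    τ     : SLabel
    delay : ℝ≥0 → SLabel

  data SysStep : QConf × QConf → SLabel → QConf × QConf → Set where
    com₁  : ∀ {C₁ C₂ C₁' C₂' m} → QStep C₁ (act out m) C₁' → QStep C₂ (act inp m) C₂' →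
            SysStep (C₁ , C₂) τ (C₁' , C₂')
    com₂  : ∀ {C₁ C₂ C₁' C₂' m} → QStep C₂ (act out m) C₂' → QStep C₁ (act inp m) C₁' →
            SysStep (C₁ , C₂) τ (C₁' , C₂')
    par₁  : ∀ {C₁ C₂ C₁'} → QStep C₁ τ C₁' → SysStep (C₁ , C₂) τ (C₁' , C₂)
    par₂  : ∀ {C₁ C₂ C₂'} → QStep C₂ τ C₂' → SysStep (C₁ , C₂) τ (C₁ , C₂')
    wait  : ∀ {C₁ C₂ C₁' C₂' t} → QStep C₁ (delay t) C₁' → QStep C₂ (delay t) C₂' →
            SysStep (C₁ , C₂) (delay t) (C₁' , C₂')

  -- compatibility ⋈ : the largest relation closed under (1)-(4),
  -- i.e. the union of all post-fixed points.

  IsCompatibility : (QConf → QConf → Set) → Set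
  IsCompatibility Rel = ∀ ν₁ S₁ M₁ ν₂ S₂ M₂ → Rel (ν₁ , S₁ , M₁) (ν₂ , S₂ , M₂) →
      (M₁ ≡ [] ⊎ M₂ ≡ [])
    × (∀ m M₁' → M₁ ≡ m ∷ M₁' → ∃[ ν₁' ] ∃[ S₁' ]
         (Act ν₁ S₁ inp m ν₁' S₁' × Rel (ν₁' , S₁' , M₁') (ν₂ , S₂ , M₂)))
    × (∀ m M₂' → M₂ ≡ m ∷ M₂' → ∃[ ν₂' ] ∃[ S₂' ]
         (Act ν₂ S₂ inp m ν₂' S₂' × Rel (ν₁ , S₁ , M₁) (ν₂' , S₂' , M₂')))
    × (M₁ ≡ [] → M₂ ≡ [] → S₁ ≡ dual S₂ × (∀ x → val (ν₁ x) ≡ val (ν₂ x)))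

  _⋈_ : QConf → QConf → Set₁
  C₁ ⋈ C₂ = Σ (QConf → QConf → Set) λ Rel → IsCompatibility Rel × Rel C₁ C₂

-- Communication and receiving steps are single actions (act/unfold) of one
-- endpoint, so the statement reduces to subject reduction for actions: the
-- chosen branch's continuation is well-formed under the constraint obtained
-- after the reset, and unfolding μα.S preserves well-formedness by a
-- substitution lemma.  For a delay t, the constraint δ of a well-formed
-- (ν, S) is either trivially true (S = end) or δ = ↓(some guard of S), so
-- δ ν makes S future-enabled at ν; rule (time) demands that future-
-- enabledness survives the delay, and an action available after ν + t puts
-- ν + t back into ↓(some guard of S) = δ.
module Submission where

open import Defs
open import Data.List using ([]; _∷_)
open import Data.List.Relation.Unary.All as All using (All; []; _∷_)
open import Data.List.Relation.Unary.Any as Any using (Any; here; there)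
open import Data.List.Relation.Unary.AllPairs using (AllPairs; []; _∷_)
open import Data.List.Membership.Propositional using (find)
open import Data.Product using (_×_; _,_; Σ; ∃-syntax; proj₁; proj₂)
open import Data.Sum using (_⊎_; inj₁; inj₂)
open import Data.Nat using (ℕ; zero; suc) renaming (_≟_ to _≟ℕ_)
open import Data.Nat.Properties using (suc-injective)
open import Data.Empty using (⊥; ⊥-elim)
open import Data.Unit using (tt)
open import Relation.Nullary using (¬_; yes; no)
open import Relation.Binary.PropositionalEquality using (_≡_; refl; sym; trans; cong)

module WellFormedness (R : Reals) (k : ℕ) where
  open Timed R k

  ≐-refl : ∀ {δ} → δ ≐ δ
  ≐-refl ν = (λ x → x) , (λ x → x)

  ≐-sym : ∀ {δ γ} → δ ≐ γ → γ ≐ δ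
  ≐-sym e ν = proj₂ (e ν) , proj₁ (e ν)

  ≐-trans : ∀ {δ γ η} → δ ≐ γ → γ ≐ η → δ ≐ η
  ≐-trans e f ν = (λ x → proj₁ (f ν) (proj₁ (e ν) x)) , (λ x → proj₂ (e ν) (proj₂ (f ν) x))

  infix 4 _⊑_
  _⊑_ : Ctx → Ctx → Set₁
  A ⊑ A' = ∀ {β δ} → A ∋ β ∶ δ → Σ Pred λ δ' → (A' ∋ β ∶ δ') × (δ ≐ δ')

  []-⊑ : ∀ {A} → [] ⊑ A
  []-⊑ ()

  ⊑-extend : ∀ {A A' α γ γ'} → γ ≐ γ' → A ⊑ A' → (α , γ) ∷ A ⊑ (α , γ') ∷ A'
  ⊑-extend e A⊑A' here = _ , here , e
  ⊑-extend e A⊑A' (there β≢α p) with A⊑A' p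
  ... | δ' , q , f = δ' , there β≢α q , f

  mutual
    ⊢-resp : ∀ {A A' γ γ' S} → A ⊑ A' → γ ≐ γ' → A ⨾ γ ⊢ S → A' ⨾ γ' ⊢ S
    ⊢-resp A⊑A' e (⊢end f) = ⊢end (≐-trans (≐-sym e) f)
    ⊢-resp A⊑A' e (⊢rec d) = ⊢rec (⊢-resp (⊑-extend e A⊑A') e d)
    ⊢-resp A⊑A' e (⊢var p f) with A⊑A' p
    ... | δ' , q , g = ⊢var q (≐-trans (≐-sym e) (≐-trans f g))
    ⊢-resp A⊑A' e (⊢choice f oks ap) = ⊢choice (≐-trans (≐-sym e) f) (BranchOK-resp A⊑A' oks) ap

    BranchOK-resp : ∀ {A A' bs} → A ⊑ A' → All (BranchOK A) bs → All (BranchOK A') bs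
    BranchOK-resp A⊑A' [] = []
    BranchOK-resp A⊑A' (ok γ d i p ∷ oks) = ok γ (⊢-resp A⊑A' ≐-refl d) i p ∷ BranchOK-resp A⊑A' oks

  infix 4 _⊑_except_
  _⊑_except_ : Ctx → Ctx → TyVar → Set₁
  A ⊑ A' except α = ∀ {β δ} → A ∋ β ∶ δ → ¬ β ≡ α → Σ Pred λ δ' → (A' ∋ β ∶ δ') × (δ ≐ δ')

  ⊑-except-shadow : ∀ {A A' α γ} → A ⊑ A' except α → (α , γ) ∷ A ⊑ (α , γ) ∷ A'
  ⊑-except-shadow A⊑A' here = _ , here , ≐-refl
  ⊑-except-shadow A⊑A' (there β≢α p) with A⊑A' p β≢α
  ... | δ' , q , g = δ' , there β≢α q , g

  ⊑-except-extend : ∀ {A A' α β γ} → A ⊑ A' except α → (β , γ) ∷ A ⊑ (β , γ) ∷ A' except α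
  ⊑-except-extend A⊑A' here _ = _ , here , ≐-refl
  ⊑-except-extend A⊑A' (there η≢β p) η≢α with A⊑A' p η≢α
  ... | δ' , q , g = δ' , there η≢β q , g

  Realises : Ctx → TyVar → Ty → Set₁
  Realises A α T = ∀ {δ} → A ∋ α ∶ δ → [] ⨾ δ ⊢ T

  Any-guard-substBs⁺ : ∀ (P : Guard → Set) bs T α →
    Any (λ b → P (guard b)) bs → Any (λ b → P (guard b)) (substBs bs T α)
  Any-guard-substBs⁺ P (br c l p g r S ∷ bs) T α (here x) = here x
  Any-guard-substBs⁺ P (br c l p g r S ∷ bs) T α (there x) = there (Any-guard-substBs⁺ P bs T α x)

  Any-guard-substBs⁻ : ∀ (P : Guard → Set) bs T α →
    Any (λ b → P (guard b)) (substBs bs T α) → Any (λ b → P (guard b)) bs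
  Any-guard-substBs⁻ P (br c l p g r S ∷ bs) T α (here x) = here x
  Any-guard-substBs⁻ P (br c l p g r S ∷ bs) T α (there x) = there (Any-guard-substBs⁻ P bs T α x)

  DisjointOrSamePol : Branch → Branch → Set
  DisjointOrSamePol b₁ b₂ = (∀ ν → ¬ (⟦ guard b₁ ⟧ ν × ⟦ guard b₂ ⟧ ν)) ⊎ pol b₁ ≡ pol b₂

  AllPairs-substBs : ∀ bs T α → AllPairs DisjointOrSamePol bs → AllPairs DisjointOrSamePol (substBs bs T α)
  AllPairs-substBs [] T α [] = []
  AllPairs-substBs (br c l p g r S ∷ bs) T α (x ∷ xs) = All-substBs bs x ∷ AllPairs-substBs bs T α xs
    where
    All-substBs : ∀ bs → All (DisjointOrSamePol (br c l p g r S)) bs →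
                  All (DisjointOrSamePol (br c l p g r (S [ T / α ]))) (substBs bs T α)
    All-substBs [] [] = []
    All-substBs (br _ _ _ _ _ _ ∷ bs) (y ∷ ys) = y ∷ All-substBs bs ys

  ↓-enabled-substBs : ∀ {bs} T α → (↓ (λ ν → Any (λ b → ⟦ guard b ⟧ ν) bs))
                                 ≐ (↓ (λ ν → Any (λ b → ⟦ guard b ⟧ ν) (substBs bs T α)))
  ↓-enabled-substBs {bs} T α ν =
      (λ { (t , a) → t , Any-guard-substBs⁺ (λ g → ⟦ g ⟧ (ν ⊕ t)) bs T α a })
    , (λ { (t , a) → t , Any-guard-substBs⁻ (λ g → ⟦ g ⟧ (ν ⊕ t)) bs T α a })

  mutual
    ⊢-subst : ∀ {A A' α T γ S} → A ⊑ A' except α → Realises A α T → A ⨾ γ ⊢ S → A' ⨾ γ ⊢ (S [ T / α ])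
    ⊢-subst A⊑A' real (⊢end f) = ⊢end f
    ⊢-subst {α = α} A⊑A' real (⊢rec {α = β} d) with α ≟ℕ β
    ... | yes refl = ⊢rec (⊢-resp (⊑-except-shadow A⊑A') ≐-refl d)
    ... | no α≢β = ⊢rec (⊢-subst (⊑-except-extend A⊑A') real' d)
      where
      real' : Realises (_ ∷ _) α _
      real' here = ⊥-elim (α≢β refl)
      real' (there _ p) = real p
    ⊢-subst {α = α} A⊑A' real (⊢var {α = β} p f) with α ≟ℕ β
    ... | yes refl = ⊢-resp []-⊑ (≐-sym f) (real p)
    ... | no α≢β with A⊑A' p (λ β≡α → α≢β (sym β≡α))
    ... | δ' , q , g = ⊢var q (≐-trans f g)
    ⊢-subst {α = α} {T} A⊑A' real (⊢choice f oks ap) =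
      ⊢choice (≐-trans f (↓-enabled-substBs T α)) (BranchOK-subst A⊑A' real oks) (AllPairs-substBs _ T α ap)

    BranchOK-subst : ∀ {A A' α T bs} → A ⊑ A' except α → Realises A α T →
                     All (BranchOK A) bs → All (BranchOK A') (substBs bs T α)
    BranchOK-subst A⊑A' real [] = []
    BranchOK-subst A⊑A' real (ok γ d i p ∷ oks) = ok γ (⊢-subst A⊑A' real d) i p ∷ BranchOK-subst A⊑A' real oks

  ⊢-unfold : ∀ {δ α S} → [] ⨾ δ ⊢ μ α S → [] ⨾ δ ⊢ (S [ μ α S / α ])
  ⊢-unfold {δ} {α} {S} (⊢rec d) = ⊢-subst ⊑[] real d
    where
    ⊑[] : (α , δ) ∷ [] ⊑ [] except α
    ⊑[] here α≢α = ⊥-elim (α≢α refl)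
    ⊑[] (there _ ())
    real : Realises ((α , δ) ∷ []) α (μ α S)
    real here = ⊢rec d
    real (there α≢α _) = ⊥-elim (α≢α refl)

  WellFormed-act : ∀ {ν S c m ν' S'} → WellFormed ν S → Act ν S c m ν' S' → WellFormed ν' S'
  WellFormed-act (δ , ⊢choice _ oks _ , _) (act {b = br _ _ _ _ _ _} b∈bs g) with All.lookup oks b∈bs
  ... | ok γ d guard⇒γ _ = γ , d , guard⇒γ _ g
  WellFormed-act (δ , d , δν) (unfold a) = WellFormed-act (δ , ⊢-unfold d , δν) a

  Enabled : Ty → Pred
  Enabled (choice bs) ν = Any (λ b → ⟦ guard b ⟧ ν) bs
  Enabled (μ α S) ν = Enabled S ν
  Enabled (var _) ν = ⊥
  Enabled end ν = ⊥

  Enabled-subst⁺ : ∀ S T α ν → Enabled S ν → Enabled (S [ T / α ]) ν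
  Enabled-subst⁺ (choice bs) T α ν e = Any-guard-substBs⁺ (λ g → ⟦ g ⟧ ν) bs T α e
  Enabled-subst⁺ (μ β S) T α ν e with α ≟ℕ β
  ... | yes _ = e
  ... | no _ = Enabled-subst⁺ S T α ν e

  Enabled-subst⁻ : ∀ S T α ν → Enabled (S [ T / α ]) ν → Enabled S ν ⊎ Enabled T ν
  Enabled-subst⁻ (choice bs) T α ν e = inj₁ (Any-guard-substBs⁻ (λ g → ⟦ g ⟧ ν) bs T α e)
  Enabled-subst⁻ (μ β S) T α ν e with α ≟ℕ β
  ... | yes _ = inj₁ e
  ... | no _ = Enabled-subst⁻ S T α ν e
  Enabled-subst⁻ (var β) T α ν e with α ≟ℕ β
  ... | yes _ = inj₂ e
  ... | no _ = ⊥-elim e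

  Act⇒Enabled : ∀ {ν S c m ν' S'} → Act ν S c m ν' S' → Enabled S ν
  Act⇒Enabled (act b∈bs g) = Any.map (λ { refl → g }) b∈bs
  Act⇒Enabled {ν} (unfold {α = α} {S = S} a) with Enabled-subst⁻ S (μ α S) α ν (Act⇒Enabled a)
  ... | inj₁ e = e
  ... | inj₂ e = e

  μ-depth : Ty → ℕ
  μ-depth (μ _ S) = suc (μ-depth S)
  μ-depth _ = zero

  μ-depth-subst : ∀ S T α ν → Enabled S ν → μ-depth (S [ T / α ]) ≡ μ-depth S
  μ-depth-subst (choice bs) T α ν e = refl
  μ-depth-subst (μ β S) T α ν e with α ≟ℕ β
  ... | yes _ = refl
  ... | no _ = cong suc (μ-depth-subst S T α ν e)

  -- Unfolding an enabled type strips one of its leading μ's, so the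
  -- recursion is on the number n of them.
  Enabled⇒Act : ∀ n S ν → μ-depth S ≡ n → Enabled S ν → ∃[ c ] ∃[ m ] ∃[ ν' ] ∃[ S' ] Act ν S c m ν' S'
  Enabled⇒Act n (choice bs) ν _ e with find e
  ... | b , b∈bs , g = _ , _ , _ , _ , act b∈bs g
  Enabled⇒Act (suc n) (μ α S) ν depth e
    with Enabled⇒Act n (S [ μ α S / α ]) ν
           (trans (μ-depth-subst S (μ α S) α ν e) (suc-injective depth))
           (Enabled-subst⁺ S (μ α S) α ν e)
  ... | c , m , ν' , S' , a = c , m , ν' , S' , unfold a

  ⊢-enabled-later : ∀ {A δ S} → A ⨾ δ ⊢ S → ∀ ν t → Enabled S (ν ⊕ t) → δ ν
  ⊢-enabled-later (⊢end f) ν t _ = proj₂ (f ν) tt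
  ⊢-enabled-later (⊢rec d) ν t e = ⊢-enabled-later d ν t e
  ⊢-enabled-later (⊢choice f _ _) ν t e = proj₂ (f ν) (t , e)

  ⊢-trivial-or-enabled-later : ∀ {A δ S ν} → A ⨾ δ ⊢ S → GoodTy S → ¬ IsVarBody S → δ ν →
                               (∀ ν' → δ ν') ⊎ ∃[ t ] Enabled S (ν ⊕ t)
  ⊢-trivial-or-enabled-later (⊢end f) _ _ _ = inj₁ (λ ν' → proj₂ (f ν') tt)
  ⊢-trivial-or-enabled-later (⊢rec d) (μ notVar good) _ δν = ⊢-trivial-or-enabled-later d good notVar δν
  ⊢-trivial-or-enabled-later (⊢var _ _) _ notVar _ = ⊥-elim (notVar tt)
  ⊢-trivial-or-enabled-later {ν = ν} (⊢choice f _ _) _ _ δν = inj₂ (proj₁ (f ν) δν)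

  closed-⊢-not-var : ∀ {δ S} → [] ⨾ δ ⊢ S → GoodTy S → ¬ IsVarBody S
  closed-⊢-not-var (⊢var () _) _
  closed-⊢-not-var (⊢end _) _ = λ ()
  closed-⊢-not-var (⊢choice _ _ _) _ = λ ()
  closed-⊢-not-var (⊢rec _) (μ notVar _) = notVar

  WellFormed-delay : ∀ {ν S} t → GoodTy S → WellFormed ν S →
                     (FutureEnabled ν S → FutureEnabled (ν ⊕ t) S) → WellFormed (ν ⊕ t) S
  WellFormed-delay {ν} {S} t good (δ , d , δν) keepsEnabled
    with ⊢-trivial-or-enabled-later d good (closed-⊢-not-var d good) δν
  ... | inj₁ trivial = δ , d , trivial (ν ⊕ t)
  ... | inj₂ (t₁ , e) with Enabled⇒Act _ S (ν ⊕ t₁) refl e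
  ... | c , m , ν' , S' , a with keepsEnabled (t₁ , c , m , ν' , S' , a)
  ... | t₂ , _ , _ , _ , _ , a' = δ , d , ⊢-enabled-later d (ν ⊕ t) t₂ (Act⇒Enabled a')

lemmaA28 : (R : Reals) (k : ℕ) → let open Timed R k in
    ∀ (ν₁ : Val) (S₁ : Ty) (M₁ : Queue) (ν₂ : Val) (S₂ : Ty) (M₂ : Queue) →
    GoodTy S₁ → GoodTy S₂ →
    All GoodMsg M₁ → All GoodMsg M₂ →
    WellFormed ν₁ S₁ → WellFormed ν₂ S₂ →
    (ν₁ , S₁ , M₁) ⋈ (ν₂ , S₂ , M₂) →
    ∀ (ℓ : SLabel) (ν₁' : Val) (S₁' : Ty) (M₁' : Queue) (ν₂' : Val) (S₂' : Ty) (M₂' : Queue) →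
    SysStep ((ν₁ , S₁ , M₁) , (ν₂ , S₂ , M₂)) ℓ ((ν₁' , S₁' , M₁') , (ν₂' , S₂' , M₂')) →
    WellFormed ν₁' S₁' × WellFormed ν₂' S₂'
lemmaA28 R k ν₁ S₁ M₁ ν₂ S₂ M₂ good₁ good₂ _ _ wf₁ wf₂ _ ℓ ν₁' S₁' M₁' ν₂' S₂' M₂' = step
  where
  open Timed R k
  open WellFormedness R k
  step : SysStep ((ν₁ , S₁ , M₁) , (ν₂ , S₂ , M₂)) ℓ ((ν₁' , S₁' , M₁') , (ν₂' , S₂' , M₂')) →
         WellFormed ν₁' S₁' × WellFormed ν₂' S₂'
  step (com₁ (send a) que) = WellFormed-act wf₁ a , wf₂
  step (com₂ (send a) que) = wf₁ , WellFormed-act wf₂ a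
  step (par₁ (recv (recv a))) = WellFormed-act wf₁ a , wf₂
  step (par₂ (recv (recv a))) = wf₁ , WellFormed-act wf₂ a
  step (wait {t = t} (time keeps₁ _) (time keeps₂ _)) =
    WellFormed-delay t good₁ wf₁ keeps₁ , WellFormed-delay t good₂ wf₂ keeps₂
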